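{- Let $F$ be a set of fields. The following are equivalent: (1) every simple matroid that is representable over all fields in $F$ has a unique minimal tropical basis; (2) the binary field $\mathbb F_2$ is in $F$.
   Context: A matroid $M=([n],\mathscr C)$ is given by its circuit set $\mathscr C$. It is simple if every circuit has cardinality greater than $2$. It is representable over a field $K$ if it is isomorphic to the matroid whose circuits are the minimal linearly dependent subsets of a finite set of vectors in a $K$-vector space. Let ${\bf TP}^{n-1}$ be the tropical projective space over $(\mathbb R\cup\{ -\infty\},\max,+)$. For a circuit $C$, $V(C)$ is the set of $x\in{\bf TP}^{n-1}$ such that $\max\{x_i : i\in C\}$ is attained at least twice. For $B\subseteq\mathscr C$, set $V(B)=\bigcap_{C\in B}V(C)$. A subset $B\subseteq\mathscr C$ is a tropical basis if $V(B)=V(\mathscr C)$. It is a minimal tropical basis if no proper subset of it is a tropical basis. -}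

module Defs where

open import Level using (_⊔_; suc; 0ℓ)
open import Algebra.Bundles using (CommutativeRing)
open import Algebra.Definitions.RawMonoid using (sum)
open import Algebra.Module.Bundles using (Module)
open import Algebra.Morphism.Structures using (module RingMorphisms)
open import Data.Bool.Base using (true; false)
open import Data.Bool.Properties using (xor-∧-commutativeRing)
open import Data.Empty using (⊥-elim)
open import Data.Fin.Base using (Fin)
open import Data.Fin.Subset as Subset using (Subset; ∣_∣; _∪_; _-_)
open import Data.Nat.Base as ℕ using (ℕ)
open import Data.Product using (Σ; ∃-syntax; ∃!; _×_; _,_)
open import Data.Rational.Base as ℚ using (ℚ; 0ℚ; 1ℚ)
import Data.Rational.Properties as ℚ
open import Data.Vec.Base using (tabulate; lookup)
open import Function.Base using (_∘_)
open import Function.Bundles using (_⇔_; _↔_; Inverse)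
open import Function.Definitions using (Injective)
open import Relation.Binary.Bundles using (Setoid)
open import Relation.Binary.PropositionalEquality using (_≡_; _≢_; refl; sym; cong; subst; module ≡-Reasoning)
open import Relation.Nullary using (¬_; yes; no)
open import Relation.Nullary.Construct.Add.Infimum using (_₋; ⊥₋; [_])
import Relation.Binary.Construct.Add.Infimum.Equality as AddInfimumEquality
import Relation.Binary.Construct.Add.Infimum.NonStrict as AddInfimumNonStrict
open import Relation.Unary using (Pred; _∈_; _∉_; _⊆_; _⊂_; _≐_)

record Field c ℓ : Set (suc (c ⊔ ℓ)) where
  field
    commutativeRing : CommutativeRing c ℓ

  open CommutativeRing commutativeRing public

  field
    1≉0     : ¬ (1# ≈ 0#)
    inverse : ∀ x → ¬ (x ≈ 0#) → ∃[ y ] x * y ≈ 1#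

𝔽₂ : Field 0ℓ 0ℓ
𝔽₂ = record
  { commutativeRing = xor-∧-commutativeRing
  ; 1≉0             = λ ()
  ; inverse         = λ { true _ → true , refl ; false f≢f → ⊥-elim (f≢f refl) }
  }

infix 4 _≅ᶠ_

_≅ᶠ_ : ∀ {c₁ ℓ₁ c₂ ℓ₂} → Field c₁ ℓ₁ → Field c₂ ℓ₂ → Set (c₁ ⊔ ℓ₁ ⊔ c₂ ⊔ ℓ₂)
K ≅ᶠ L = ∃[ φ ] RingMorphisms.IsRingIsomorphism (Field.rawRing K) (Field.rawRing L) φ

Family : ℕ → Set₁
Family n = Pred (Subset n) 0ℓ

record Matroid (n : ℕ) : Set₁ where
  field
    Circuit        : Family n
    ∅-not-circuit  : Subset.⊥ ∉ Circuit
    incomparable   : ∀ {C D} → C ∈ Circuit → D ∈ Circuit → C Subset.⊆ D → C ≡ D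
    elimination    : ∀ {C D e} → C ∈ Circuit → D ∈ Circuit → C ≢ D →
                     e Subset.∈ C → e Subset.∈ D →
                     ∃[ E ] E ∈ Circuit × E Subset.⊆ (C ∪ D) - e

Simple : ∀ {n} → Matroid n → Set
Simple M = ∀ {C} → C ∈ Matroid.Circuit M → ∣ C ∣ ℕ.> 2

image : ∀ {m n} → Fin m ↔ Fin n → Subset m → Subset n
image σ S = tabulate (lookup S ∘ Inverse.from σ)

Isomorphic : ∀ {m n ℓ₁ ℓ₂} → Pred (Subset m) ℓ₁ → Pred (Subset n) ℓ₂ → Set (ℓ₁ ⊔ ℓ₂)
Isomorphic {m} {n} 𝒞 𝒟 = Σ (Fin m ↔ Fin n) λ σ → ∀ S → S ∈ 𝒞 ⇔ image σ S ∈ 𝒟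

module _ {c ℓ w ℓw} (K : Field c ℓ) (W : Module (Field.commutativeRing K) w ℓw) where
  open Field K
  open Module W using (Carrierᴹ; _≈ᴹ_; _*ₗ_; 0ᴹ; +ᴹ-rawMonoid)

  LinearlyDependent : ∀ {m} → (Fin m → Carrierᴹ) → Pred (Subset m) (c ⊔ ℓ ⊔ ℓw)
  LinearlyDependent {m} v S = Σ (Fin m → Carrier) λ a →
    (∀ i → i Subset.∉ S → a i ≈ 0#) ×
    (∃[ i ] i Subset.∈ S × ¬ (a i ≈ 0#)) ×
    sum +ᴹ-rawMonoid (λ i → a i *ₗ v i) ≈ᴹ 0ᴹ

  MinimallyDependent : ∀ {m} → (Fin m → Carrierᴹ) → Pred (Subset m) (c ⊔ ℓ ⊔ ℓw)
  MinimallyDependent v S =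
    LinearlyDependent v S × (∀ T → T Subset.⊂ S → ¬ LinearlyDependent v T)

-- A finite set of vectors is an injective family.  Vector spaces are taken in
-- the universe levels of K, where every Kʳ lives.
Representable : ∀ {n c ℓ} → Matroid n → Field c ℓ → Set (suc (c ⊔ ℓ))
Representable {c = c} {ℓ = ℓ} M K =
  Σ (Module (Field.commutativeRing K) c ℓ) λ W → let open Module W in
  ∃[ m ] Σ (Fin m → Carrierᴹ) λ v →
    Injective _≡_ _≈ᴹ_ v × Isomorphic (Matroid.Circuit M) (MinimallyDependent K W v)

-- Real numbers as lower Dedekind cuts of ℚ.  This one-sided notion agrees with
-- the usual real numbers under excluded middle.

record ℝ : Set₁ where
  field
    Lower     : Pred ℚ 0ℓ
    inhabited : ∃[ q ] q ∈ Lower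
    proper    : ∃[ q ] q ∉ Lower
    closed    : ∀ {p q} → p ℚ.≤ q → q ∈ Lower → p ∈ Lower
    rounded   : ∀ {p} → p ∈ Lower → ∃[ q ] p ℚ.< q × q ∈ Lower

open ℝ

infix  4 _≤_ _≃_
infixl 6 _+_

_≤_ _≃_ : ℝ → ℝ → Set
x ≤ y = Lower x ⊆ Lower y
x ≃ y = Lower x ≐ Lower y

0ℝ : ℝ
0ℝ = record
  { Lower     = ℚ._< 0ℚ
  ; inhabited = ℚ.- 1ℚ , ℚ.negative⁻¹ (ℚ.- 1ℚ)
  ; proper    = 0ℚ , ℚ.<-irrefl refl
  ; closed    = ℚ.≤-<-trans
  ; rounded   = λ p<0 → let q , p<q , q<0 = ℚ.<-dense p<0 in q , p<q , q<0
  }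

below : ∀ x {p q} → p ∈ Lower x → q ∉ Lower x → p ℚ.< q
below x {p} {q} p∈x q∉x with q ℚ.≤? p
... | yes q≤p = ⊥-elim (q∉x (closed x q≤p p∈x))
... | no  q≰p = ℚ.≰⇒> q≰p

_+_ : ℝ → ℝ → ℝ
x + y = record
  { Lower     = λ q → ∃[ r ] ∃[ s ] r ∈ Lower x × s ∈ Lower y × q ℚ.≤ r ℚ.+ s
  ; inhabited = let r , r∈x = inhabited x ; s , s∈y = inhabited y
                in r ℚ.+ s , r , s , r∈x , s∈y , ℚ.≤-refl
  ; proper    = let b , b∉x = proper x ; d , d∉y = proper y
                in b ℚ.+ d , λ { (r , s , r∈x , s∈y , b+d≤r+s) →
                     ℚ.<-irrefl refl (ℚ.<-≤-trans (ℚ.+-mono-< (below x r∈x b∉x) (below y s∈y d∉y)) b+d≤r+s) }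
  ; closed    = λ { p≤q (r , s , r∈x , s∈y , q≤r+s) →
                  r , s , r∈x , s∈y , ℚ.≤-trans p≤q q≤r+s }
  ; rounded   = λ { (r , s , r∈x , s∈y , p≤r+s) → let r′ , r<r′ , r′∈x = rounded x r∈x in
                  r′ ℚ.+ s , ℚ.≤-<-trans p≤r+s (ℚ.+-monoˡ-< s r<r′) ,
                  r′ , s , r′∈x , s∈y , ℚ.≤-refl }
  }

𝕋 : Set₁
𝕋 = ℝ ₋

open AddInfimumNonStrict _≤_ public using (_≤₋_; ⊥₋≤_; [_]; ≤₋-trans)
open AddInfimumEquality _≃_ public using (_≈₋_; ⊥₋≈⊥₋; [_]; ≈₋-trans; ≈₋-sym)

infixr 7 _⊙_

_⊙_ : ℝ → 𝕋 → 𝕋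
c ⊙ ⊥₋    = ⊥₋
c ⊙ [ x ] = [ c + x ]

≤-trans : ∀ {x y z} → x ≤ y → y ≤ z → x ≤ z
≤-trans x≤y y≤z q∈x = y≤z (x≤y q∈x)

≃-trans : ∀ {x y z} → x ≃ y → y ≃ z → x ≃ z
≃-trans (a , b) (c , d) = (λ p → c (a p)) , (λ p → b (d p))

≃-sym : ∀ {x y} → x ≃ y → y ≃ x
≃-sym (a , b) = b , a

+-monoʳ-≤ : ∀ c {x y} → x ≤ y → c + x ≤ c + y
+-monoʳ-≤ c x≤y (r , s , r∈c , s∈x , q≤) = r , s , r∈c , x≤y s∈x , q≤

0+-identity : ∀ x → x ≃ 0ℝ + x
0+-identity x =
  (λ {q} q∈x → let s , q<s , s∈x = rounded x q∈x in
    q ℚ.- s , s ,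
    subst (q ℚ.- s ℚ.<_) (ℚ.+-inverseʳ s) (ℚ.+-monoˡ-< (ℚ.- s) q<s) , s∈x ,
    ℚ.≤-reflexive (sym (q-s+s≡q q s))) ,
  (λ { {q} (r , s , r<0 , s∈x , q≤r+s) → closed x
    (ℚ.≤-trans q≤r+s (subst (r ℚ.+ s ℚ.≤_) (ℚ.+-identityˡ s)
      (ℚ.+-monoˡ-≤ s (ℚ.<⇒≤ r<0)))) s∈x })
  where
  open ≡-Reasoning
  q-s+s≡q : ∀ q s → (q ℚ.- s) ℚ.+ s ≡ q
  q-s+s≡q q s = begin
    (q ℚ.- s) ℚ.+ s       ≡⟨ ℚ.+-assoc q (ℚ.- s) s ⟩
    q ℚ.+ (ℚ.- s ℚ.+ s)   ≡⟨ cong (q ℚ.+_) (ℚ.+-inverseˡ s) ⟩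
    q ℚ.+ 0ℚ              ≡⟨ ℚ.+-identityʳ q ⟩
    q                     ∎

+-assoc : ∀ x y z → x + (y + z) ≃ (x + y) + z
+-assoc x y z =
  (λ { (r , s , r∈x , (t , u , t∈y , u∈z , s≤t+u) , q≤r+s) →
    r ℚ.+ t , u , (r , t , r∈x , t∈y , ℚ.≤-refl) , u∈z ,
    ℚ.≤-trans q≤r+s (subst (r ℚ.+ s ℚ.≤_) (sym (ℚ.+-assoc r t u)) (ℚ.+-monoʳ-≤ r s≤t+u)) }) ,
  (λ { (r , s , (t , u , t∈x , u∈y , r≤t+u) , s∈z , q≤r+s) →
    t , u ℚ.+ s , t∈x , (u , s , u∈y , s∈z , ℚ.≤-refl) ,
    ℚ.≤-trans q≤r+s (subst (r ℚ.+ s ℚ.≤_) (ℚ.+-assoc t u s) (ℚ.+-monoˡ-≤ s r≤t+u)) })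

⊙-identity : ∀ t → t ≈₋ 0ℝ ⊙ t
⊙-identity ⊥₋    = ⊥₋≈⊥₋
⊙-identity [ x ] = [ 0+-identity x ]

⊙-assoc : ∀ c d t → c ⊙ d ⊙ t ≈₋ (c + d) ⊙ t
⊙-assoc c d ⊥₋    = ⊥₋≈⊥₋
⊙-assoc c d [ x ] = [ +-assoc c d x ]

⊙-cong : ∀ c {t u} → t ≈₋ u → c ⊙ t ≈₋ c ⊙ u
⊙-cong c ⊥₋≈⊥₋ = ⊥₋≈⊥₋
⊙-cong c {[ x ]} {[ y ]} [ a , b ] = [ +-monoʳ-≤ c {x} {y} a , +-monoʳ-≤ c {y} {x} b ]

⊙-mono : ∀ c {t u} → t ≤₋ u → c ⊙ t ≤₋ c ⊙ u
⊙-mono c (⊥₋≤ u) = ⊥₋≤ _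
⊙-mono c {[ x ]} {[ y ]} [ p ] = [ +-monoʳ-≤ c {x} {y} p ]

≈₋⇒≤₋ : ∀ {t u} → t ≈₋ u → t ≤₋ u
≈₋⇒≤₋ ⊥₋≈⊥₋     = ⊥₋≤ _
≈₋⇒≤₋ [ a , _ ] = [ a ]

Multiple : ∀ {n} → (Fin n → 𝕋) → Pred (Fin n → 𝕋) (suc 0ℓ)
Multiple x y = ∃[ c ] ∀ i → y i ≈₋ c ⊙ x i

Multiple-trans : ∀ {n} {x y z : Fin n → 𝕋} → y ∈ Multiple x → z ∈ Multiple y → z ∈ Multiple x
Multiple-trans {x = x} (c , y≈) (d , z≈) = d + c , λ i →
  tr (z≈ i) (tr (⊙-cong d (y≈ i)) (⊙-assoc d c (x i)))
  where
  tr : ∀ {t u v} → t ≈₋ u → u ≈₋ v → t ≈₋ v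
  tr = ≈₋-trans (λ {a} {b} {c} → ≃-trans {a} {b} {c})

-- TP n is the (n-1)-dimensional space, with n homogeneous coordinates: vectors
-- other than (-∞,…,-∞) up to tropical scaling.  The equivalence asks for scalars
-- in both directions, since inverting a lower cut is not constructive.
TP : ℕ → Setoid (suc 0ℓ) (suc 0ℓ)
TP n = record
  { Carrier       = Σ (Fin n → 𝕋) λ x → ∃[ i ] x i ≢ ⊥₋
  ; _≈_           = λ { (x , _) (y , _) → y ∈ Multiple x × x ∈ Multiple y }
  ; isEquivalence = record
    { refl  = λ { {x , _} → (0ℝ , ⊙-identity ∘ x) , (0ℝ , ⊙-identity ∘ x) }
    ; sym   = λ { (p , q) → q , p }
    ; trans = λ { (p , q) (p′ , q′) → Multiple-trans p p′ , Multiple-trans q′ q }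
    }
  }

Point : ℕ → Set₁
Point n = Setoid.Carrier (TP n)

MaxAttainedAt : ∀ {n} → (Fin n → 𝕋) → Subset n → Pred (Fin n) (suc 0ℓ)
MaxAttainedAt x C i = i Subset.∈ C × (∀ k → k Subset.∈ C → x k ≤₋ x i)

V : ∀ {n} → Subset n → Pred (Point n) (suc 0ℓ)
V C (x , _) = ∃[ i ] ∃[ j ] i ≢ j × MaxAttainedAt x C i × MaxAttainedAt x C j

V-resp-≈ : ∀ {n} (C : Subset n) {x y} → Setoid._≈_ (TP n) x y → x ∈ V C → y ∈ V C
V-resp-≈ C {x , _} {y , _} ((c , y≈) , _) (i , j , i≢j , (i∈C , max-i) , (j∈C , max-j)) =
  i , j , i≢j , (i∈C , λ k k∈C → step (max-i k k∈C)) , (j∈C , λ k k∈C → step (max-j k k∈C))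
  where
  tr : ∀ {t u v} → t ≤₋ u → u ≤₋ v → t ≤₋ v
  tr = ≤₋-trans (λ {a} {b} {c} → ≤-trans {a} {b} {c})
  step : ∀ {k l} → x k ≤₋ x l → y k ≤₋ y l
  step {k} {l} p = tr (≈₋⇒≤₋ (y≈ k))
    (tr (⊙-mono c p) (≈₋⇒≤₋ (≈₋-sym (λ {a} {b} → ≃-sym {a} {b}) (y≈ l))))

⋂V : ∀ {n} → Family n → Pred (Point n) (suc 0ℓ)
⋂V B x = ∀ {C} → C ∈ B → x ∈ V C

TropicalBasis : ∀ {n} → Matroid n → Family n → Set₁
TropicalBasis M B = B ⊆ Circuit × ⋂V B ≐ ⋂V Circuit
  where open Matroid M

MinimalTropicalBasis : ∀ {n} → Matroid n → Family n → Set₁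
MinimalTropicalBasis M B =
  TropicalBasis M B × (∀ B′ → B′ ⊂ B → ¬ TropicalBasis M B′)

HasUniqueMinimalTropicalBasis : ∀ {n} → Matroid n → Set₁
HasUniqueMinimalTropicalBasis M = ∃! _≐_ (MinimalTropicalBasis M)

{-# OPTIONS --safe #-}
module Submission where

-- Binary ⇒ unique.  If a circuit C is the sum of two circuits meeting in a single
-- element (a chord of C), then V C contains the intersection of their two
-- hypersurfaces; as chords split C into smaller circuits, the chordless circuits
-- form a tropical basis.  Conversely, if C is chordless and a ∈ C, the point equal
-- to −∞ on C - a and to 0 elsewhere lies on V D for every circuit D ≠ C but not on
-- V C: a circuit D with exactly one element outside C - a would, in a binary
-- matroid, make that element a chord of C.  So every tropical basis contains all
-- chordless circuits.
--
-- Unique ⇒ 𝔽₂ ∈ F.  U₂,₄ is representable over every field with an element other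
-- than 0 and 1, and any three of its four circuits form a minimal tropical basis.

open import Defs
open import Axiom.ExcludedMiddle using (ExcludedMiddle)
open import Data.Product using (∃-syntax; _×_)
open import Function.Bundles using (_⇔_)
open import Relation.Unary using (Pred; _∈_)

open import Level using (Level) renaming (suc to lsuc)
open import Algebra.Module.Bundles using (Module)
import Algebra.Module.Construct.DirectProduct as DirectProduct
import Algebra.Module.Construct.TensorUnit as TensorUnit
open import Algebra.Morphism.Structures using (module RingMorphisms)
import Algebra.Properties.CommutativeMonoid.Sum as Sum
import Algebra.Properties.Ring as RingProperties
open import Data.Bool.Base using (Bool; true; false; _xor_; _∧_; if_then_else_)
open import Data.Empty using (⊥; ⊥-elim)
open import Data.Fin.Base using (Fin; zero; suc; punchIn)
open import Data.Fin.Patterns using (0F; 1F; 2F; 3F)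
open import Data.Fin.Properties using (_≟_; punchInᵢ≢i)
open import Data.Fin.Subset as Subset using (Subset; ∣_∣; _∪_; _-_; ∁; ⁅_⁆; Nonempty; inside; outside)
open import Data.Fin.Subset.Properties
open import Data.Nat.Base as ℕ using (ℕ; s≤s)
open import Data.Nat.Induction using (<-wellFounded)
import Data.Nat.Properties as ℕ
import Data.Rational.Properties as ℚ
open import Data.Product using (_,_; proj₁; proj₂)
open import Data.Sum.Base as Sum⊎ using (_⊎_; inj₁; inj₂)
open import Data.Vec.Base using ([]; _∷_; here; there; lookup; tabulate; zipWith)
open import Data.Vec.Properties using (lookup∘tabulate; tabulate∘lookup; tabulate-cong; lookup-zipWith; lookup⇒[]=; []=⇒lookup)
open import Function.Base using (_∘_; id)
open import Function.Bundles using (Inverse; Equivalence; mk⇔; _↔_)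
open import Function.Construct.Identity using (↔-id)
open import Function.Construct.Symmetry using (↔-sym)
open import Induction.WellFounded using (Acc; acc)
open import Relation.Binary.PropositionalEquality as ≡ using (_≡_; _≢_; refl; cong; cong₂; subst)
open import Relation.Nullary using (¬_; yes; no; decidable-stable)
open import Relation.Nullary.Construct.Add.Infimum using (⊥₋; [_])
import Relation.Binary.Construct.Add.Infimum.NonStrict as AddInfimum
import Relation.Binary.Reasoning.Setoid as SetoidReasoning
open import Relation.Unary using (_⊆_)

private variable
  n : ℕ
  z : Level

-- Finite subsets

x∈p─q⇒x∉q : ∀ (p q : Subset n) {x} → x Subset.∈ (p Subset.─ q) → x Subset.∉ q
x∈p─q⇒x∉q (_ ∷ p) (inside  ∷ q) {zero}  ()
x∈p─q⇒x∉q (_ ∷ p) (outside ∷ q) {zero}  _  ()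
x∈p─q⇒x∉q (_ ∷ p) (_ ∷ q)       {suc x} x∈ x∈q = x∈p─q⇒x∉q p q (drop-there x∈) (drop-there x∈q)

x∈p-y⇒x≢y : ∀ (p : Subset n) {x y} → x Subset.∈ p - y → x ≢ y
x∈p-y⇒x≢y p {y = y} x∈ refl = x∈p─q⇒x∉q p ⁅ y ⁆ x∈ (x∈⁅x⁆ y)

∣p∣≤1+∣p-x∣ : ∀ (p : Subset n) x → ∣ p ∣ ℕ.≤ ℕ.suc ∣ p - x ∣
∣p∣≤1+∣p-x∣ (inside  ∷ p) zero    = ℕ.≤-reflexive (cong (ℕ.suc ∘ ∣_∣) (≡.sym (p─⊥≡p p)))
∣p∣≤1+∣p-x∣ (outside ∷ p) zero    = ℕ.m≤n⇒m≤1+n (ℕ.≤-reflexive (cong ∣_∣ (≡.sym (p─⊥≡p p))))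
∣p∣≤1+∣p-x∣ (inside  ∷ p) (suc x) = s≤s (∣p∣≤1+∣p-x∣ p x)
∣p∣≤1+∣p-x∣ (outside ∷ p) (suc x) = ∣p∣≤1+∣p-x∣ p x

∣p∣>0⇒Nonempty : ∀ (p : Subset n) → ∣ p ∣ ℕ.> 0 → Nonempty p
∣p∣>0⇒Nonempty {n} p p>0 with nonempty? p
... | yes ne = ne
... | no  ¬ne = ⊥-elim (ℕ.<⇒≢ p>0 (≡.sym (≡.trans (cong ∣_∣ (Empty-unique ¬ne)) (∣⊥∣≡0 n))))

∣p∣>1⇒∃≢ : ∀ (p : Subset n) → ∣ p ∣ ℕ.> 1 → ∀ x → ∃[ y ] y Subset.∈ p × y ≢ x
∣p∣>1⇒∃≢ p p>1 x =
  let y , y∈ = ∣p∣>0⇒Nonempty (p - x) (ℕ.≤-pred (ℕ.≤-trans p>1 (∣p∣≤1+∣p-x∣ p x)))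
  in y , p─q⊆p p ⁅ x ⁆ y∈ , x∈p-y⇒x≢y p y∈

∣p∣>2⇒∃≢≢ : ∀ (p : Subset n) → ∣ p ∣ ℕ.> 2 → ∀ x y →
  ∃[ w ] w Subset.∈ p × w ≢ x × w ≢ y
∣p∣>2⇒∃≢≢ p p>2 x y =
  let w , w∈ , w≢y = ∣p∣>1⇒∃≢ (p - x) (ℕ.≤-pred (ℕ.≤-trans p>2 (∣p∣≤1+∣p-x∣ p x))) y
  in w , p─q⊆p p ⁅ x ⁆ w∈ , x∈p-y⇒x≢y p w∈ , w≢y

x∈∁⁅y⁆ : ∀ {x y : Fin n} → x ≢ y → x Subset.∈ ∁ ⁅ y ⁆
x∈∁⁅y⁆ x≢y = x∉p⇒x∈∁p (x≢y⇒x∉⁅y⁆ x≢y)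

x∈∁⁅y⁆⇒x≢y : ∀ {x y : Fin n} → x Subset.∈ ∁ ⁅ y ⁆ → x ≢ y
x∈∁⁅y⁆⇒x≢y x∈ = x∉⁅y⁆⇒x≢y (x∈∁p⇒x∉p x∈)

x∉∁⁅y⁆⇒x≡y : ∀ {x y : Fin n} → x Subset.∉ ∁ ⁅ y ⁆ → x ≡ y
x∉∁⁅y⁆⇒x≡y {y = y} x∉ = x∈⁅y⁆⇒x≡y y (x∉∁p⇒x∈p x∉)

infixr 6 _△_

-- Bitwise `xor` treats subsets as vectors over 𝔽₂, so that `bit-xor` can match `△` with addition of
-- coefficients.
_△_ : Subset n → Subset n → Subset n
_△_ = zipWith _xor_

x∈p△q⁺ˡ : ∀ {p q : Subset n} {x} → x Subset.∈ p → x Subset.∉ q → x Subset.∈ p △ q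
x∈p△q⁺ˡ {p = _ ∷ p} {inside  ∷ q} here x∉q = ⊥-elim (x∉q here)
x∈p△q⁺ˡ {p = _ ∷ p} {outside ∷ q} here x∉q = here
x∈p△q⁺ˡ {p = _ ∷ p} {_ ∷ q} (there x∈p) x∉q = there (x∈p△q⁺ˡ x∈p (x∉q ∘ there))

x∈p△q⁺ʳ : ∀ {p q : Subset n} {x} → x Subset.∉ p → x Subset.∈ q → x Subset.∈ p △ q
x∈p△q⁺ʳ {p = inside  ∷ p} {_ ∷ q} x∉p here = ⊥-elim (x∉p here)
x∈p△q⁺ʳ {p = outside ∷ p} {_ ∷ q} x∉p here = here
x∈p△q⁺ʳ {p = _ ∷ p} {_ ∷ q} x∉p (there x∈q) = there (x∈p△q⁺ʳ (x∉p ∘ there) x∈q)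

x∈p△q⁻ : ∀ (p q : Subset n) {x} → x Subset.∈ p △ q →
  (x Subset.∈ p × x Subset.∉ q) ⊎ (x Subset.∉ p × x Subset.∈ q)
x∈p△q⁻ (inside  ∷ p) (outside ∷ q) {zero} x∈ = inj₁ (here , λ ())
x∈p△q⁻ (outside ∷ p) (inside  ∷ q) {zero} x∈ = inj₂ ((λ ()) , here)
x∈p△q⁻ (inside  ∷ p) (inside  ∷ q) {zero} ()
x∈p△q⁻ (outside ∷ p) (outside ∷ q) {zero} ()
x∈p△q⁻ (_ ∷ p) (_ ∷ q) {suc x} (there x∈) =
  Sum⊎.map (λ (a , b) → there a , b ∘ drop-there) (λ (a , b) → a ∘ drop-there , there b)
    (x∈p△q⁻ p q x∈)

-- Images of subsets under bijections

module _ {m n} (σ : Fin m ↔ Fin n) where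
  open Inverse σ using (to; from; strictlyInverseˡ; strictlyInverseʳ)

  lookup-image : ∀ S j → lookup (image σ S) j ≡ lookup S (from j)
  lookup-image S = lookup∘tabulate (lookup S ∘ from)

  ∈-image⁺ : ∀ {S i} → i Subset.∈ S → to i Subset.∈ image σ S
  ∈-image⁺ {S} {i} i∈S = lookup⇒[]= (to i) (image σ S)
    (≡.trans (lookup-image S (to i)) (≡.trans (cong (lookup S) (strictlyInverseʳ i)) ([]=⇒lookup i∈S)))

  ∈-image⁻ : ∀ {S j} → j Subset.∈ image σ S → from j Subset.∈ S
  ∈-image⁻ {S} {j} j∈ = lookup⇒[]= (from j) S (≡.trans (≡.sym (lookup-image S j)) ([]=⇒lookup j∈))

  ∈-image⁻-to : ∀ {S i} → to i Subset.∈ image σ S → i Subset.∈ S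
  ∈-image⁻-to {S} {i} i∈ = subst (Subset._∈ S) (strictlyInverseʳ i) (∈-image⁻ i∈)

  image-⊂ : ∀ {S T} → S Subset.⊂ T → image σ S Subset.⊂ image σ T
  image-⊂ {S} {T} (S⊆T , i , i∈T , i∉S) =
    (λ {j} j∈ → subst (Subset._∈ image σ T) (strictlyInverseˡ j) (∈-image⁺ (S⊆T (∈-image⁻ j∈)))) ,
    to i , ∈-image⁺ i∈T , i∉S ∘ ∈-image⁻-to

image-sym : ∀ {m n} (σ : Fin m ↔ Fin n) S → image σ (image (↔-sym σ) S) ≡ S
image-sym σ S = ≡.trans
  (tabulate-cong λ j → ≡.trans (lookup-image (↔-sym σ) S (from j)) (cong (lookup S) (strictlyInverseˡ j)))
  (tabulate∘lookup S)
  where open Inverse σ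

image-⊂⁻ : ∀ {m n} (σ : Fin m ↔ Fin n) {S T} → S Subset.⊂ image σ T → image (↔-sym σ) S Subset.⊂ T
image-⊂⁻ σ {S} {T} (S⊆ , j , j∈ , j∉S) =
  (λ i∈ → ∈-image⁻-to σ (S⊆ (∈-image⁻ (↔-sym σ) i∈))) ,
  from j , ∈-image⁻ σ j∈ , j∉S ∘ ∈-image⁻-to (↔-sym σ)
  where open Inverse σ

image-△ : ∀ {m n} (σ : Fin m ↔ Fin n) S T → image σ (S △ T) ≡ image σ S △ image σ T
image-△ σ S T = ≡.trans (tabulate-cong λ j → ≡.trans (lookup-zipWith _xor_ (from j) S T)
    (≡.sym (≡.trans (lookup-zipWith _xor_ j (image σ S) (image σ T))
      (cong₂ _xor_ (lookup-image σ S j) (lookup-image σ T j)))))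
  (tabulate∘lookup _)
  where open Inverse σ

-- Tropical hypersurfaces of circuits

≤₋-refl : ∀ {t} → t ≤₋ t
≤₋-refl {⊥₋}    = ⊥₋≤ ⊥₋
≤₋-refl {[ x ]} = [ id ]

≤₋-transitive : ∀ {t u v} → t ≤₋ u → u ≤₋ v → t ≤₋ v
≤₋-transitive = ≤₋-trans (λ {x} {y} {z} → ≤-trans {x} {y} {z})

-- Of two distinct maximisers at most one is `e`.
V⇒∃≢ : ∀ {C : Subset n} (x : Point n) → x ∈ V C → ∀ e → ∃[ i ] i ≢ e × MaxAttainedAt (proj₁ x) C i
V⇒∃≢ x (i , j , i≢j , max-i , max-j) e with i ≟ e
... | no  i≢e  = i , i≢e , max-i
... | yes refl = j , i≢j ∘ ≡.sym , max-j

max⇒V : ∀ {C : Subset n} (x : Point n) {i j} → MaxAttainedAt (proj₁ x) C i →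
  j Subset.∈ C → i ≢ j → proj₁ x i ≤₋ proj₁ x j → x ∈ V C
max⇒V x {i} {j} (i∈C , max-i) j∈C i≢j xi≤xj =
  i , j , i≢j , (i∈C , max-i) , (j∈C , λ k k∈C → ≤₋-transitive (max-i k k∈C) xi≤xj)

indicator : Subset n → Fin n → 𝕋
indicator S i = if lookup S i then [ 0ℝ ] else ⊥₋

indicator-∈ : ∀ {S : Subset n} {i} → i Subset.∈ S → indicator S i ≡ [ 0ℝ ]
indicator-∈ i∈S rewrite []=⇒lookup i∈S = refl

indicator-≤ : ∀ (S : Subset n) {i j} → (i Subset.∈ S → j Subset.∈ S) → indicator S i ≤₋ indicator S j
indicator-≤ S {i} {j} i⇒j with lookup S i in eq
... | false = ⊥₋≤ _
... | true rewrite []=⇒lookup (i⇒j (lookup⇒[]= i S eq)) = [ id ]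

indicator-≤⁻ : ∀ (S : Subset n) {i j} → indicator S i ≤₋ indicator S j → i Subset.∈ S → j Subset.∈ S
indicator-≤⁻ S {i} {j} i≤j i∈S rewrite []=⇒lookup i∈S with lookup S j in eq | i≤j
... | true  | _ = lookup⇒[]= j S eq
... | false | ()

point : (S : Subset n) → Nonempty S → Point n
point S (i , i∈S) = indicator S , i , λ xi≡⊥ → case (≡.trans (≡.sym (indicator-∈ i∈S)) xi≡⊥)
  where
  case : ∀ {x : ℝ} → [ x ] ≢ ⊥₋
  case ()

-- If `C` has more than one element, `point S ne` is on `V C` unless `C` meets `S` exactly once.
-- Here two elements are common and the maximum is 0; the next two lemmas treat no common element,
-- where all of `C` sits at -∞, and a single one.
point∈V : ∀ {S C : Subset n} (ne : Nonempty S) {i j} → i ≢ j → i Subset.∈ C → j Subset.∈ C →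
  i Subset.∈ S → j Subset.∈ S → point S ne ∈ V C
point∈V {S = S} ne {i} {j} i≢j i∈C j∈C i∈S j∈S =
  i , j , i≢j , (i∈C , λ k _ → indicator-≤ S λ _ → i∈S) , (j∈C , λ k _ → indicator-≤ S λ _ → j∈S)

point∈V-disjoint : ∀ {S C : Subset n} (ne : Nonempty S) → ∣ C ∣ ℕ.> 1 →
  (∀ {k} → k Subset.∈ C → k Subset.∉ S) → point S ne ∈ V C
point∈V-disjoint {S = S} {C} ne C>1 disjoint =
  let i , i∈C = ∣p∣>0⇒Nonempty C (ℕ.<⇒≤ C>1)
      j , j∈C , j≢i = ∣p∣>1⇒∃≢ C C>1 i
  in j , i , j≢i , (j∈C , λ k k∈C → indicator-≤ S λ k∈S → ⊥-elim (disjoint k∈C k∈S))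
                 , (i∈C , λ k k∈C → indicator-≤ S λ k∈S → ⊥-elim (disjoint k∈C k∈S))

point∉V : ∀ {S C : Subset n} (ne : Nonempty S) {i} → i Subset.∈ C → i Subset.∈ S →
  (∀ {k} → k Subset.∈ C → k Subset.∈ S → k ≡ i) → ¬ (point S ne ∈ V C)
point∉V {S = S} ne {i} i∈C i∈S unique x∈V =
  let j , j≢i , j∈C , max-j = V⇒∃≢ (point S ne) x∈V i
  in j≢i (unique j∈C (indicator-≤⁻ S (max-j i i∈C) i∈S))

-- Binary matroids

-- C is the sum C₁ △ C₂ of two circuits meeting exactly in the chord e.
record HasChord (M : Matroid n) (C : Subset n) : Set where
  field
    {C₁ C₂}   : Subset n
    {e}       : Fin n
    circuit₁  : C₁ ∈ Matroid.Circuit M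
    circuit₂  : C₂ ∈ Matroid.Circuit M
    e∈C₁      : e Subset.∈ C₁
    e∈C₂      : e Subset.∈ C₂
    meet      : ∀ {i} → i Subset.∈ C₁ → i Subset.∈ C₂ → i ≡ e
    ⊆-sum     : ∀ {i} → i Subset.∈ C → i Subset.∈ C₁ ⊎ i Subset.∈ C₂
    sum-⊆₁    : ∀ {i} → i Subset.∈ C₁ → i ≢ e → i Subset.∈ C
    sum-⊆₂    : ∀ {i} → i Subset.∈ C₂ → i ≢ e → i Subset.∈ C

HasChord-swap : ∀ {M : Matroid n} {C} → HasChord M C → HasChord M C
HasChord-swap ch = record
  { circuit₁ = circuit₂ ; circuit₂ = circuit₁ ; e∈C₁ = e∈C₂ ; e∈C₂ = e∈C₁
  ; meet = λ i∈₁ i∈₂ → meet i∈₂ i∈₁ ; ⊆-sum = Sum⊎.swap ∘ ⊆-sum ; sum-⊆₁ = sum-⊆₂ ; sum-⊆₂ = sum-⊆₁ }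
  where open HasChord ch

-- By simplicity `C₂` adds to `C` two elements `f` and `g` outside `C₁`: trading `e` for `f` still
-- leaves `g` to spare.
∣C₁∣<∣C∣ : ∀ {M : Matroid n} {C} → Simple M → (ch : HasChord M C) → ∣ HasChord.C₁ ch ∣ ℕ.< ∣ C ∣
∣C₁∣<∣C∣ {C = C} simple ch =
  let f , f∈C₂ , f≢e = ∣p∣>1⇒∃≢ C₂ (ℕ.<⇒≤ (simple circuit₂)) e
      g , g∈C₂ , g≢e , g≢f = ∣p∣>2⇒∃≢≢ C₂ (simple circuit₂) e f
      C₁-e⊂C-f : C₁ - e Subset.⊂ C - f
      C₁-e⊂C-f =
        (λ {i} i∈ → let i∈C₁ = p─q⊆p C₁ ⁅ e ⁆ i∈ in
          x∈p∧x≢y⇒x∈p-y (sum-⊆₁ i∈C₁ (x∈p-y⇒x≢y C₁ i∈))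
            λ { refl → f≢e (meet i∈C₁ f∈C₂) }) ,
        g , x∈p∧x≢y⇒x∈p-y (sum-⊆₂ g∈C₂ g≢e) g≢f ,
        λ g∈ → g≢e (meet (p─q⊆p C₁ ⁅ e ⁆ g∈) g∈C₂)
  in ℕ.≤-<-trans (∣p∣≤1+∣p-x∣ C₁ e)
       (ℕ.≤-<-trans (p⊂q⇒∣p∣<∣q∣ C₁-e⊂C-f) (x∈p⇒∣p-x∣<∣p∣ (sum-⊆₂ f∈C₂ f≢e)))
  where open HasChord ch

-- What a binary representation contributes to the combinatorics: a family closed under sums whose
-- minimal nonempty members are the circuits. The empty set may be a cycle, whence the `Nonempty`
-- conditions.
record BinaryCycleSpace {n} (M : Matroid n) z : Set (lsuc z) where
  open Matroid M
  field
    Cycle         : Pred (Subset n) z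
    △-closed      : ∀ {S T} → S ∈ Cycle → T ∈ Cycle → S △ T ∈ Cycle
    circuit⇒cycle : ∀ {C} → C ∈ Circuit → C ∈ Cycle
    minimal       : ∀ {C T} → C ∈ Circuit → T Subset.⊂ C → Nonempty T → ¬ (T ∈ Cycle)
    minimal⇒circuit : ∀ {C} → C ∈ Cycle → Nonempty C →
      (∀ T → T Subset.⊂ C → Nonempty T → ¬ (T ∈ Cycle)) → C ∈ Circuit

module _ {M : Matroid n} (simple : Simple M) (space : BinaryCycleSpace M z) where
  open Matroid M
  open BinaryCycleSpace space

  -- The other half is `E = C △ D`, made of `d` and the part of `C` outside `D`; so `D` and `E` meet
  -- only in `d` and sum to `C`. The work lies in showing that the cycle `E` is minimal.
  one-outside⇒HasChord : ∀ {C D d} → C ∈ Circuit → D ∈ Circuit → d Subset.∈ D → d Subset.∉ C →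
    (∀ {i} → i Subset.∈ D → i ≢ d → i Subset.∈ C) → HasChord M C
  one-outside⇒HasChord {C} {D} {d} C∈ D∈ d∈D d∉C D-d⊆C = record
    { circuit₁ = D∈ ; circuit₂ = E∈ ; e∈C₁ = d∈D ; e∈C₂ = d∈E
    ; meet = meet′
    ; ⊆-sum = ⊆-sum′
    ; sum-⊆₁ = D-d⊆C
    ; sum-⊆₂ = E-d⊆C
    }
    where
    E = C △ D

    d∈E : d Subset.∈ E
    d∈E = x∈p△q⁺ʳ d∉C d∈D

    E-d⊆C : ∀ {i} → i Subset.∈ E → i ≢ d → i Subset.∈ C
    E-d⊆C i∈E i≢d with x∈p△q⁻ C D i∈E
    ... | inj₁ (i∈C , _)   = i∈C
    ... | inj₂ (i∉C , i∈D) = D-d⊆C i∈D i≢d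

    meet′ : ∀ {i} → i Subset.∈ D → i Subset.∈ E → i ≡ d
    meet′ {i} i∈D i∈E with i ≟ d | x∈p△q⁻ C D i∈E
    ... | yes i≡d | _                = i≡d
    ... | no  i≢d | inj₁ (_ , i∉D)   = ⊥-elim (i∉D i∈D)
    ... | no  i≢d | inj₂ (i∉C , _)   = ⊥-elim (i∉C (D-d⊆C i∈D i≢d))

    ⊆-sum′ : ∀ {i} → i Subset.∈ C → i Subset.∈ D ⊎ i Subset.∈ E
    ⊆-sum′ {i} i∈C with i ∈? D
    ... | yes i∈D = inj₁ i∈D
    ... | no  i∉D = inj₂ (x∈p△q⁺ˡ i∈C i∉D)

    -- This element of `D` lies in `C` but not in `E`. In `E-minimal` it makes `T` proper in `C` in
    -- one case and `T △ D` nonempty in the other.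
    other : ∃[ f ] f Subset.∈ D × f ≢ d
    other = ∣p∣>1⇒∃≢ D (ℕ.<⇒≤ (simple D∈)) d

    f = proj₁ other
    f∈D = proj₁ (proj₂ other)
    f≢d = proj₂ (proj₂ other)

    -- A cycle properly inside E would give one properly inside C: itself if it
    -- avoids d, and its sum with D otherwise.
    E-minimal : ∀ T → T Subset.⊂ E → Nonempty T → ¬ (T ∈ Cycle)
    E-minimal T (T⊆E , g , g∈E , g∉T) T≠∅ T∈ with d ∈? T
    ... | no d∉T = minimal C∈
            ((λ {i} i∈T → E-d⊆C (T⊆E i∈T) λ { refl → d∉T i∈T }) ,
             f , D-d⊆C f∈D f≢d , λ f∈T → f≢d (meet′ f∈D (T⊆E f∈T)))
            T≠∅ T∈
    -- `g` is in `E` but not in `T`, hence differs from `d` and avoids `D`; it shows that `T △ D` is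
    -- proper in `C`.
    ... | yes d∈T = minimal C∈ (T△D⊆C , g , E-d⊆C g∈E g≢d , g∉T△D)
            (f , x∈p△q⁺ʳ (λ f∈T → f≢d (meet′ f∈D (T⊆E f∈T))) f∈D)
            (△-closed T∈ (circuit⇒cycle D∈))
      where
      g≢d : g ≢ d
      g≢d refl = g∉T d∈T

      g∉T△D : g Subset.∉ T △ D
      g∉T△D g∈ with x∈p△q⁻ T D g∈
      ... | inj₁ (g∈T , _) = g∉T g∈T
      ... | inj₂ (_ , g∈D) = g≢d (meet′ g∈D g∈E)

      T△D⊆C : T △ D Subset.⊆ C
      T△D⊆C i∈ with x∈p△q⁻ T D i∈
      ... | inj₁ (i∈T , i∉D) = E-d⊆C (T⊆E i∈T) λ { refl → i∉D d∈D }
      ... | inj₂ (i∉T , i∈D) = D-d⊆C i∈D λ { refl → i∉T d∈T }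

    E∈ : E ∈ Circuit
    E∈ = minimal⇒circuit (△-closed (circuit⇒cycle C∈) (circuit⇒cycle D∈)) (d , d∈E) E-minimal

-- Fields isomorphic to 𝔽₂ and cycle spaces of representations over them

module Bits {c ℓ} (K : Field c ℓ) where
  open Field K hiding (zero; sym; refl; trans)
  private module K = Field K

  bit : Bool → Carrier
  bit b = if b then 1# else 0#

  bit-injective : ∀ {b b′} → bit b ≈ bit b′ → b ≡ b′
  bit-injective {true}  {true}  _ = refl
  bit-injective {true}  {false} p = ⊥-elim (1≉0 p)
  bit-injective {false} {true}  p = ⊥-elim (1≉0 (K.sym p))
  bit-injective {false} {false} _ = refl

  bit-∧ : ∀ b b′ → bit (b ∧ b′) ≈ bit b * bit b′
  bit-∧ true  b′ = K.sym (*-identityˡ _)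
  bit-∧ false b′ = K.sym (zeroˡ _)

  module _ (1+1≈0 : 1# K.+ 1# ≈ 0#) where
    bit-xor : ∀ b b′ → bit (b xor b′) ≈ bit b K.+ bit b′
    bit-xor true  true  = K.sym 1+1≈0
    bit-xor true  false = K.sym (+-identityʳ 1#)
    bit-xor false b′    = K.sym (+-identityˡ _)

    bit-neg : ∀ b → bit b ≈ - bit b
    bit-neg true  = RingProperties.+-inverseʳ-unique ring 1# 1# 1+1≈0
    bit-neg false = K.sym (RingProperties.-0#≈0# ring)

  -- Since `1≉0`, each element equals exactly one bit, and every homomorphism law reduces to that
  -- uniqueness.
  all-bits⇒≅𝔽₂ : (∀ x → ∃[ b ] x ≈ bit b) → K ≅ᶠ 𝔽₂
  all-bits⇒≅𝔽₂ bits = φ , record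
    { isRingMonomorphism = record
      { isRingHomomorphism = record
        { isSemiringHomomorphism = record
          { isNearSemiringHomomorphism = record
            { +-isMonoidHomomorphism = record
              { isMagmaHomomorphism = record
                { isRelHomomorphism = record { cong = φ-cong }
                ; homo = λ x y → φ-unique (K.trans (+-cong (φ-bit x) (φ-bit y)) (K.sym (bit-xor 1+1≈0 (φ x) (φ y)))) }
              ; ε-homo = φ-unique {b = false} K.refl }
            ; *-homo = λ x y → φ-unique (K.trans (*-cong (φ-bit x) (φ-bit y)) (K.sym (bit-∧ (φ x) (φ y)))) }
          ; 1#-homo = φ-unique {b = true} K.refl }
        ; -‿homo = λ x → φ-unique (K.trans (-‿cong (φ-bit x)) (K.sym (bit-neg 1+1≈0 (φ x)))) }
      ; injective = λ {x} {y} φx≡φy → K.trans (φ-bit x) (K.trans (reflexive (cong bit φx≡φy)) (K.sym (φ-bit y))) }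
    ; surjective = λ b → bit b , φ-unique
    }
    where
    φ : Carrier → Bool
    φ x = proj₁ (bits x)

    φ-bit : ∀ x → x ≈ bit (φ x)
    φ-bit x = proj₂ (bits x)

    φ-unique : ∀ {x b} → x ≈ bit b → φ x ≡ b
    φ-unique x≈ = bit-injective (K.trans (K.sym (φ-bit _)) x≈)

    φ-cong : ∀ {x y} → x ≈ y → φ x ≡ φ y
    φ-cong x≈y = φ-unique (K.trans x≈y (φ-bit _))

    1+1≈0 : 1# K.+ 1# ≈ 0#
    1+1≈0 with bits (1# K.+ 1#)
    ... | false , p = p
    -- `1 + 1 ≈ 1` would cancel to `1 ≈ 0`.
    ... | true  , p = ⊥-elim (1≉0 (RingProperties.+-cancelˡ ring 1# 1# 0# (K.trans p (K.sym (+-identityʳ 1#)))))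

  module _ (K≅𝔽₂ : K ≅ᶠ 𝔽₂) where
    φ = proj₁ K≅𝔽₂
    open RingMorphisms.IsRingIsomorphism (proj₂ K≅𝔽₂)

    φ-bit : ∀ b → φ (bit b) ≡ b
    φ-bit true  = 1#-homo
    φ-bit false = 0#-homo

    x≈bit : ∀ x → x ≈ bit (φ x)
    x≈bit x = injective (≡.sym (φ-bit (φ x)))

    char2 : 1# K.+ 1# ≈ 0#
    char2 = injective (≡.trans (+-homo 1# 1#) (≡.trans (cong₂ _xor_ 1#-homo 1#-homo) (≡.sym 0#-homo)))

    module _ {w ℓw m} (W : Module commutativeRing w ℓw) (v : Fin m → Module.Carrierᴹ W) where
      open Module W
      open Sum +ᴹ-commutativeMonoid using (sum; sum-cong-≋; ∑-distrib-+)

      -- The kernel of the linear map from 𝔽₂-coefficients to `W`, each coefficient vector being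
      -- identified with its support.
      VectorCycle : Pred (Subset m) ℓw
      VectorCycle S = sum (λ i → bit (lookup S i) *ₗ v i) ≈ᴹ 0ᴹ

      VectorCycle-△ : ∀ {S T} → S ∈ VectorCycle → T ∈ VectorCycle → S △ T ∈ VectorCycle
      VectorCycle-△ {S} {T} S∈ T∈ =
        ≈ᴹ-trans (sum-cong-≋ λ i → ≈ᴹ-trans
          (*ₗ-congʳ (K.trans (reflexive (cong bit (lookup-zipWith _xor_ i S T))) (bit-xor char2 (lookup S i) (lookup T i))))
          (*ₗ-distribʳ (v i) (bit (lookup S i)) (bit (lookup T i))))
        (≈ᴹ-trans (∑-distrib-+ (λ i → bit (lookup S i) *ₗ v i) (λ i → bit (lookup T i) *ₗ v i))
        (≈ᴹ-trans (+ᴹ-cong S∈ T∈) (+ᴹ-identityˡ 0ᴹ)))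

      cycle⇒dependent : ∀ {S} → S ∈ VectorCycle → Nonempty S → S ∈ LinearlyDependent K W v
      cycle⇒dependent {S} S∈ (i , i∈S) = (λ i → bit (lookup S i)) , outside-S ,
        (i , i∈S , λ p → 1≉0 (K.trans (reflexive (cong bit (≡.sym ([]=⇒lookup i∈S)))) p)) , S∈
        where
        outside-S : ∀ i → i Subset.∉ S → bit (lookup S i) ≈ 0#
        outside-S i i∉S with lookup S i in eq
        ... | false = K.refl
        ... | true  = ⊥-elim (i∉S (lookup⇒[]= i S eq))

      -- `T` is the support of the coefficients, possibly smaller than `S`. Nonzero coefficients
      -- equal 1, so the given relation already is the sum of the vectors indexed by `T`.
      dependent⇒cycle : ∀ {S} → S ∈ LinearlyDependent K W v →
        ∃[ T ] T Subset.⊆ S × Nonempty T × T ∈ VectorCycle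
      dependent⇒cycle {S} (a , outside-S , (i , i∈S , ai≉0) , ∑≈0) = T , T⊆S ,
        (i , lookup⇒[]= i T (≡.trans (lookup∘tabulate (φ ∘ a) i) φai≡true)) ,
        ≈ᴹ-trans (sum-cong-≋ λ j → *ₗ-congʳ
          (K.trans (reflexive (cong bit (lookup∘tabulate (φ ∘ a) j))) (K.sym (x≈bit (a j))))) ∑≈0
        where
        T = tabulate (φ ∘ a)

        φai≡true : φ (a i) ≡ true
        φai≡true with φ (a i) | x≈bit (a i)
        ... | true  | _ = refl
        ... | false | p = ⊥-elim (ai≉0 p)

        T⊆S : T Subset.⊆ S
        T⊆S {j} j∈T with j ∈? S
        ... | yes j∈S = j∈S
        ... | no  j∉S = ⊥-elim (1≉0 (K.trans
          (K.sym (K.trans (x≈bit (a j)) (reflexive (cong bit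
            (≡.trans (≡.sym (lookup∘tabulate (φ ∘ a) j)) ([]=⇒lookup j∈T))))))
          (outside-S j j∉S)))

    cycleSpace : {M : Matroid n} → Representable M K → BinaryCycleSpace M ℓ
    cycleSpace {M = M} (W , m , v , _ , σ , circuit⇔) = record
      { Cycle = Z
      ; △-closed = λ {S} {T} S∈ T∈ → subst (VectorCycle W v) (≡.sym (image-△ σ S T))
          (VectorCycle-△ W v {image σ S} {image σ T} S∈ T∈)
      ; circuit⇒cycle = is-cycle
      ; minimal = λ { {T = T} C∈ T⊂C (i , i∈T) T∈ → proj₂ (Equivalence.to (circuit⇔ _) C∈) _ (image-⊂ σ T⊂C)
          (cycle⇒dependent W v T∈ (_ , ∈-image⁺ σ i∈T)) }
      ; minimal⇒circuit = is-circuit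
      }
      where
      Z : Pred (Subset _) ℓ
      Z S = image σ S ∈ VectorCycle W v

      -- A nonempty cycle inside the image of a circuit is dependent, so minimality forces it to be
      -- all of that image.
      is-cycle : ∀ {C} → C ∈ Matroid.Circuit M → C ∈ Z
      is-cycle {C} C∈ =
        let dep , min = Equivalence.to (circuit⇔ C) C∈
            T , T⊆C , T≠∅ , T∈ = dependent⇒cycle W v dep
            C⊆T : image σ C Subset.⊆ T
            C⊆T {i} i∈C = decidable-stable (i ∈? T) λ i∉T →
              min T (T⊆C , i , i∈C , i∉T) (cycle⇒dependent W v T∈ T≠∅)
        in subst (VectorCycle W v) (⊆-antisym T⊆C C⊆T) T∈

      -- A dependent proper subset would contain a nonempty cycle, which pulls back along `σ` to one
      -- properly inside `C`.
      is-circuit : ∀ {C} → C ∈ Z → Nonempty C → (∀ T → T Subset.⊂ C → Nonempty T → ¬ (T ∈ Z)) →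
        C ∈ Matroid.Circuit M
      is-circuit {C} C∈ (i , i∈C) min = Equivalence.from (circuit⇔ C)
        (cycle⇒dependent W v C∈ (_ , ∈-image⁺ σ i∈C) , λ T T⊂C dep →
          let S , S⊆T , (j , j∈S) , S∈ = dependent⇒cycle W v dep
          in min (image (↔-sym σ) S) (image-⊂⁻ σ (⊆-⊂-trans S⊆T T⊂C)) (_ , ∈-image⁺ (↔-sym σ) j∈S)
               (subst (VectorCycle W v) (≡.sym (image-sym σ S)) S∈))

-- Chordless circuits as the unique minimal tropical basis

module _ (em : ∀ {a} → ExcludedMiddle a) where

  -- A rational in the cut `x` but not in `y` bounds `y` from above, which puts all of `y` inside
  -- `x`.
  ≤-total : ∀ x y → x ≤ y ⊎ y ≤ x
  ≤-total x y with em {P = ∃[ q ] q ∈ ℝ.Lower x × ¬ (q ∈ ℝ.Lower y)}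
  ... | yes (q , q∈x , q∉y) = inj₂ λ p∈y → ℝ.closed x (ℚ.<⇒≤ (below y p∈y q∉y)) q∈x
  ... | no  ¬q              = inj₁ λ {q} q∈x → decidable-stable em λ q∉y → ¬q (q , q∈x , q∉y)

  ≤₋-total : ∀ t u → t ≤₋ u ⊎ u ≤₋ t
  ≤₋-total = AddInfimum.≤₋-total _≤_ ≤-total

  -- Domination makes a maximiser `i ≢ e` on `C₁` a maximiser on `C`. A second one on `C₁` also
  -- serves for `C` unless it is the chord.
  V-chord-dominated : ∀ {M : Matroid n} {C} (x : Point n) (ch : HasChord M C) → let open HasChord ch in
    x ∈ V C₁ → x ∈ V C₂ → ∀ {i₀} → i₀ Subset.∈ C₁ →
    (∀ k → k Subset.∈ C₂ → proj₁ x k ≤₋ proj₁ x i₀) → x ∈ V C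
  V-chord-dominated {C = C} x ch x∈V₁ x∈V₂ {i₀} i₀∈C₁ dominated with V⇒∃≢ x x∈V₁ (HasChord.e ch)
  ... | i , i≢e , i∈C₁ , max-i with V⇒∃≢ x x∈V₁ i
  ... | j , j≢i , j∈C₁ , max-j = conclude
    where
    open HasChord ch

    max : MaxAttainedAt (proj₁ x) C i
    max = sum-⊆₁ i∈C₁ i≢e , λ k k∈C → Sum⊎.[ max-i k ,
      (λ k∈C₂ → ≤₋-transitive (dominated k k∈C₂) (max-i i₀ i₀∈C₁)) ]′ (⊆-sum k∈C)

    conclude : x ∈ V C
    conclude with j ≟ e
    ... | no  j≢e  = max⇒V x max (sum-⊆₁ j∈C₁ j≢e) (j≢i ∘ ≡.sym) (max-j i i∈C₁)
    -- The chord may be lost in `C`, but `C₂` has a maximiser `k ≢ e` at least as high, and `k`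
    -- differs from `i` because the two circuits meet only in `e`.
    ... | yes refl with V⇒∃≢ x x∈V₂ e
    ... | k , k≢e , k∈C₂ , max-k = max⇒V x max (sum-⊆₂ k∈C₂ k≢e) (λ { refl → i≢e (meet i∈C₁ k∈C₂) })
            (≤₋-transitive (max-j i i∈C₁) (max-k e e∈C₂))

  -- The circuit with the larger maximum takes the role of `C₁` in `V-chord-dominated`.
  V-chord : ∀ {M : Matroid n} {C} (x : Point n) (ch : HasChord M C) →
    x ∈ V (HasChord.C₁ ch) → x ∈ V (HasChord.C₂ ch) → x ∈ V C
  V-chord x ch x∈V₁@(i , _ , _ , (i∈C₁ , max-i) , _) x∈V₂@(j , _ , _ , (j∈C₂ , max-j) , _)
    with ≤₋-total (proj₁ x i) (proj₁ x j)
  ... | inj₁ i≤j = V-chord-dominated x (HasChord-swap ch) x∈V₂ x∈V₁ j∈C₂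
                     λ k k∈C₁ → ≤₋-transitive (max-i k k∈C₁) i≤j
  ... | inj₂ j≤i = V-chord-dominated x ch x∈V₁ x∈V₂ i∈C₁
                     λ k k∈C₂ → ≤₋-transitive (max-j k k∈C₂) j≤i

  module _ {M : Matroid n} (simple : Simple M) where
    open Matroid M

    Chordless : Family n
    Chordless C = C ∈ Circuit × ¬ HasChord M C

    -- Well-founded induction on cardinality: a circuit with a chord inherits the condition from two
    -- smaller circuits.
    chordless-basis : TropicalBasis M Chordless
    chordless-basis = proj₁ , (λ {x} x∈ {C} C∈ → go x x∈ C∈ (<-wellFounded ∣ C ∣)) , λ x∈ C∈ → x∈ (proj₁ C∈)
      where
      go : ∀ x → x ∈ ⋂V Chordless → ∀ {C} → C ∈ Circuit → Acc ℕ._<_ ∣ C ∣ → x ∈ V C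
      go x x∈ {C} C∈ (acc smaller) with em {P = HasChord M C}
      ... | no  ¬ch = x∈ (C∈ , ¬ch)
      ... | yes ch  = V-chord x ch
              (go x x∈ circuit₁ (smaller (∣C₁∣<∣C∣ {M = M} simple ch)))
              (go x x∈ circuit₂ (smaller (∣C₁∣<∣C∣ {M = M} simple (HasChord-swap ch))))
        where open HasChord ch

    module _ (space : BinaryCycleSpace M z) where

      chordless⊆basis : ∀ {B} → TropicalBasis M B → Chordless ⊆ B
      chordless⊆basis {B} (B⊆ , ⋂B⊆ , _) {C} (C∈ , ¬ch) = decidable-stable em λ C∉B →
        point∉V ne a∈C a∈S C∩S (⋂B⊆ {x} (λ {D} → x∈VD C∉B {D}) C∈)
        where
        C≠∅ = ∣p∣>0⇒Nonempty C (ℕ.<⇒≤ (ℕ.<⇒≤ (simple C∈)))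
        a = proj₁ C≠∅
        a∈C = proj₂ C≠∅

        -- `a` together with everything outside `C`, so that `C` meets `S` in `a` alone and its
        -- hypersurface misses the point.
        S = ∁ (C - a)

        a∈S : a Subset.∈ S
        a∈S = x∉p⇒x∈∁p λ a∈ → x∈p-y⇒x≢y C a∈ refl

        ne : Nonempty S
        ne = a , a∈S

        x = point S ne

        C∩S : ∀ {k} → k Subset.∈ C → k Subset.∈ S → k ≡ a
        C∩S {k} k∈C k∈S with k ≟ a
        ... | yes k≡a = k≡a
        ... | no  k≢a = ⊥-elim (x∈∁p⇒x∉p k∈S (x∈p∧x≢y⇒x∈p-y k∈C k≢a))

        ∉S⇒∈C : ∀ {k} → k Subset.∉ S → k Subset.∈ C
        ∉S⇒∈C k∉S = p─q⊆p C ⁅ a ⁆ (x∉∁p⇒x∈p k∉S)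

        x∈VD : ¬ (C ∈ B) → ∀ {D} → D ∈ B → x ∈ V D
        x∈VD C∉B {D} D∈B with nonempty? (D Subset.∩ S)
        ... | no  empty = point∈V-disjoint ne (ℕ.<⇒≤ (simple (B⊆ D∈B)))
                            λ k∈D k∈S → empty (_ , x∈p∩q⁺ (k∈D , k∈S))
        ... | yes (d , d∈) with x∈p∩q⁻ D S d∈
        ... | d∈D , d∈S with em {P = ∃[ j ] d ≢ j × j Subset.∈ D × j Subset.∈ S}
        ... | yes (j , d≢j , j∈D , j∈S) = point∈V ne d≢j d∈D j∈D d∈S j∈S
        -- All of `D` except `d` lies in `C`. If `d` does too, then `D` equals `C`, contrary to
        -- `C∉B`; otherwise `d` is a chord of `C`.
        ... | no  alone = ⊥-elim impossible
          where
          D-d⊆C : ∀ {i} → i Subset.∈ D → i ≢ d → i Subset.∈ C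
          D-d⊆C i∈D i≢d = ∉S⇒∈C λ i∈S → alone (_ , i≢d ∘ ≡.sym , i∈D , i∈S)

          D⊆C : d Subset.∈ C → D Subset.⊆ C
          D⊆C d∈C {i} i∈D with i ≟ d
          ... | yes refl = d∈C
          ... | no  i≢d  = D-d⊆C i∈D i≢d

          impossible : ⊥
          impossible with d ∈? C
          ... | yes d∈C = C∉B (subst B (incomparable (B⊆ D∈B) C∈ (D⊆C d∈C)) D∈B)
          ... | no  d∉C = ¬ch (one-outside⇒HasChord simple space C∈ (B⊆ D∈B) d∈D d∉C D-d⊆C)

      -- `Chordless` is a basis contained in every basis, so no proper subfamily is one and every
      -- minimal basis coincides with it.
      binary⇒unique : HasUniqueMinimalTropicalBasis M
      binary⇒unique = Chordless ,
        (chordless-basis , λ B′ (_ , ¬⊆) basis → ¬⊆ (chordless⊆basis basis)) ,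
        λ {B} (basis , min) → chordless⊆basis basis ,
          decidable-stable em λ B⊈ → min Chordless (chordless⊆basis basis , B⊈) chordless-basis

-- The uniform matroid U₂,₄

U₂,₄ : Matroid 4
U₂,₄ = record
  { Circuit       = λ C → ∃[ p ] C ≡ ∁ ⁅ p ⁆
  ; ∅-not-circuit = λ { (p , ⊥≡) → ∉⊥ (subst (punchIn p 0F Subset.∈_) (≡.sym ⊥≡) (x∈∁⁅y⁆ (punchInᵢ≢i p 0F))) }
  ; incomparable  = λ { {_} {_} (p , refl) (q , refl) C⊆D →
      cong (∁ ∘ ⁅_⁆) (≡.sym (x∉∁⁅y⁆⇒x≡y λ q∈C → x∈∁⁅y⁆⇒x≢y (C⊆D q∈C) refl)) }
  -- For distinct `p` and `q` the two complements cover everything, so the triple missing `e` fits.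
  ; elimination   = λ { {_} {_} {e} (p , refl) (q , refl) C≢D _ _ →
      ∁ ⁅ e ⁆ , (e , refl) , λ {i} i∈ → x∈p∧x≢y⇒x∈p-y (x∈∪ p q C≢D i) (x∈∁⁅y⁆⇒x≢y i∈) }
  }
  where
  x∈∪ : ∀ p q → ∁ ⁅ p ⁆ ≢ ∁ ⁅ q ⁆ → ∀ i → i Subset.∈ ∁ ⁅ p ⁆ ∪ ∁ ⁅ q ⁆
  x∈∪ p q p≢q i with i ≟ p
  ... | no  i≢p  = x∈p∪q⁺ (inj₁ (x∈∁⁅y⁆ i≢p))
  ... | yes refl = x∈p∪q⁺ (inj₂ (x∈∁⁅y⁆ λ i≡q → p≢q (cong (∁ ∘ ⁅_⁆) i≡q)))

U₂,₄-simple : Simple U₂,₄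
U₂,₄-simple (p , refl) = ℕ.≤-reflexive (≡.sym (≡.trans (∣∁p∣≡n∸∣p∣ ⁅ p ⁆) (cong (4 ℕ.∸_) (∣⁅x⁆∣≡1 p))))

Omitting : Fin 4 → Family 4
Omitting p C = ∃[ q ] q ≢ p × C ≡ ∁ ⁅ q ⁆

module _ (em : ∀ {a} → ExcludedMiddle a) where

  omitting-basis : ∀ p → TropicalBasis U₂,₄ (Omitting p)
  omitting-basis p = (λ (q , _ , eq) → q , eq) ,
    (λ { {x} x∈ {_} (q , refl) → all-V x (λ q q≢p → x∈ (q , q≢p , refl)) q }) ,
    λ x∈ (q , _ , eq) → x∈ (q , eq)
    where
    module _ (x : Point 4) (x∈ : ∀ q → q ≢ p → x ∈ V (∁ ⁅ q ⁆)) where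
      x̂ = proj₁ x

      -- Some `q ≢ p` is compared with a maximiser `i ≢ p` on its complement; the larger is a global
      -- maximiser.
      maximum : ∃[ a ] a ≢ p × (∀ k → x̂ k ≤₋ x̂ a)
      maximum with punchIn p 0F | punchInᵢ≢i p 0F
      ... | q | q≢p with V⇒∃≢ x (x∈ q q≢p) p
      ... | i , i≢p , i∈ , max-i with ≤₋-total em (x̂ q) (x̂ i)
      ... | inj₁ q≤i = i , i≢p , case-k
        where
        case-k : ∀ k → x̂ k ≤₋ x̂ i
        case-k k with k ≟ q
        ... | yes refl = q≤i
        ... | no  k≢q  = max-i k (x∈∁⁅y⁆ k≢q)
      ... | inj₂ i≤q = q , q≢p , case-k
        where
        case-k : ∀ k → x̂ k ≤₋ x̂ q
        case-k k with k ≟ q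
        ... | yes refl = ≤₋-refl
        ... | no  k≢q  = ≤₋-transitive (max-i k (x∈∁⁅y⁆ k≢q)) i≤q

      -- `a` is a global maximiser, `b` a maximiser off `a`, and `i ≢ a` a maximiser off `b`, hence
      -- as high as `a`. If `i ≢ p`, it joins `a` on `∁ ⁅ p ⁆`; if `i` is `p`, then `b` is at least
      -- as high as `p` and joins `a` instead.
      omitted-V : x ∈ V (∁ ⁅ p ⁆)
      omitted-V with maximum
      ... | a , a≢p , max-a with V⇒∃≢ x (x∈ a a≢p) p
      ... | b , b≢p , b∈ , max-b with V⇒∃≢ x (x∈ b b≢p) a
      ... | i , i≢a , i∈ , max-i with i ≟ p
      ... | no  i≢p  = max⇒V x (x∈∁⁅y⁆ a≢p , λ k _ → max-a k) (x∈∁⁅y⁆ i≢p) (i≢a ∘ ≡.sym)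
                         (max-i a (x∈∁⁅y⁆ (x∈∁⁅y⁆⇒x≢y b∈ ∘ ≡.sym)))
      ... | yes refl = max⇒V x (x∈∁⁅y⁆ a≢p , λ k _ → max-a k) (x∈∁⁅y⁆ b≢p) (x∈∁⁅y⁆⇒x≢y b∈ ∘ ≡.sym)
                         (≤₋-transitive (max-i a (x∈∁⁅y⁆ (x∈∁⁅y⁆⇒x≢y b∈ ∘ ≡.sym)))
                                        (max-b p (x∈∁⁅y⁆ (a≢p ∘ ≡.sym))))

      all-V : ∀ q → x ∈ V (∁ ⁅ q ⁆)
      all-V q with q ≟ p
      ... | no  q≢p  = x∈ q q≢p
      ... | yes refl = omitted-V

  -- If the circuits ∁ p and ∁ q are both dropped, the indicator of {p , q} lies on
  -- all remaining hypersurfaces but not on that of ∁ q.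
  omitting-minimal : ∀ p → MinimalTropicalBasis U₂,₄ (Omitting p)
  omitting-minimal p = omitting-basis p , λ B′ (B′⊆ , ⊈B′) (_ , ⋂B′⊆ , _) →
    ⊈B′ λ { {_} (q , q≢p , refl) → decidable-stable em λ q∉B′ →
      point∉V (ne q) {p} (x∈∁⁅y⁆ (q≢p ∘ ≡.sym)) (p∈S q)
        (λ k∈C k∈S → Sum⊎.[ x∈⁅y⁆⇒x≡y p , (λ k∈q → ⊥-elim (x∈∁p⇒x∉p k∈C k∈q)) ]′ (x∈p∪q⁻ ⁅ p ⁆ ⁅ q ⁆ k∈S))
        (⋂B′⊆ {point (S q) (ne q)} (λ {D} D∈ → remaining B′ B′⊆ q q≢p q∉B′ D∈) (q , refl)) }
    where
    S : Fin 4 → Subset 4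
    S q = ⁅ p ⁆ ∪ ⁅ q ⁆

    p∈S : ∀ q → p Subset.∈ S q
    p∈S q = x∈p∪q⁺ (inj₁ (x∈⁅x⁆ p))

    ne : ∀ q → Nonempty (S q)
    ne q = p , p∈S q

    remaining : ∀ B′ → B′ ⊆ Omitting p → ∀ q → q ≢ p → ¬ (∁ ⁅ q ⁆ ∈ B′) →
      ∀ {D} → D ∈ B′ → point (S q) (ne q) ∈ V D
    remaining B′ B′⊆ q q≢p q∉B′ D∈ with B′⊆ D∈
    ... | r , r≢p , refl = point∈V (ne q) (q≢p ∘ ≡.sym) (x∈∁⁅y⁆ (r≢p ∘ ≡.sym))
            (x∈∁⁅y⁆ λ { refl → q∉B′ D∈ }) (p∈S q) (x∈p∪q⁺ (inj₂ (x∈⁅x⁆ q)))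

  -- A unique `B` would coincide with both `Omitting 0F` and `Omitting 1F`, but `∁ ⁅ 1F ⁆` belongs
  -- only to the former.
  U₂,₄-not-unique : ¬ HasUniqueMinimalTropicalBasis U₂,₄
  U₂,₄-not-unique (B , _ , unique)
    with proj₁ (unique (omitting-minimal 1F)) (proj₂ (unique (omitting-minimal 0F)) (1F , (λ ()) , refl))
  ... | q , q≢1 , eq = q≢1 (≡.sym (x∉∁⁅y⁆⇒x≡y λ 1∈ → x∈∁⁅y⁆⇒x≢y (subst (1F Subset.∈_) (≡.sym eq) 1∈) refl))

-- A representation of U₂,₄ by four vectors in a plane

module Plane {c ℓ} (K : Field c ℓ) where
  open Bits K using (bit; all-bits⇒≅𝔽₂)
  open Field K hiding (zero; sym; refl; trans)
  private
    module K = Field K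
    K² : Module commutativeRing c ℓ
    K² = DirectProduct.⟨module⟩ TensorUnit.⟨module⟩ TensorUnit.⟨module⟩

  x≈0∧x+y≈0⇒y≈0 : ∀ {x y} → x ≈ 0# → x K.+ y ≈ 0# → y ≈ 0#
  x≈0∧x+y≈0⇒y≈0 x≈0 p = K.trans (K.sym (+-identityˡ _)) (K.trans (+-congʳ (K.sym x≈0)) p)

  y≈0∧x+y≈0⇒x≈0 : ∀ {x y} → y ≈ 0# → x K.+ y ≈ 0# → x ≈ 0#
  y≈0∧x+y≈0⇒x≈0 y≈0 p = x≈0∧x+y≈0⇒y≈0 y≈0 (K.trans (K.+-comm _ _) p)

  x*y≈0⇒x≈0 : ∀ {x y} → ¬ (y ≈ 0#) → x * y ≈ 0# → x ≈ 0#
  x*y≈0⇒x≈0 {x} {y} y≉0 p = let y⁻¹ , yy⁻¹≈1 = inverse y y≉0 in begin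
    x               ≈⟨ *-identityʳ x ⟨
    x * 1#          ≈⟨ *-congˡ yy⁻¹≈1 ⟨
    x * (y * y⁻¹)   ≈⟨ *-assoc x y y⁻¹ ⟨
    x * y * y⁻¹     ≈⟨ *-congʳ p ⟩
    0# * y⁻¹        ≈⟨ zeroˡ y⁻¹ ⟩
    0#              ∎
    where open SetoidReasoning K.setoid

  module _ (t : Carrier) (t≉0 : ¬ (t ≈ 0#)) (t≉1 : ¬ (t ≈ 1#)) where

    -- Four distinct points of the projective line, as `t` avoids 0 and 1: any two are independent
    -- and any three dependent.
    vectors : Fin 4 → Carrier × Carrier
    vectors 0F = 1# , 0#
    vectors 1F = 0# , 1#
    vectors 2F = 1# , 1#
    vectors 3F = 1# , t

    vectors-injective : ∀ {i j} → Module._≈ᴹ_ K² (vectors i) (vectors j) → i ≡ j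
    vectors-injective {0F} {0F} _ = refl
    vectors-injective {0F} {1F} (p , _) = ⊥-elim (1≉0 p)
    vectors-injective {0F} {2F} (_ , p) = ⊥-elim (1≉0 (K.sym p))
    vectors-injective {0F} {3F} (_ , p) = ⊥-elim (t≉0 (K.sym p))
    vectors-injective {1F} {0F} (_ , p) = ⊥-elim (1≉0 p)
    vectors-injective {1F} {1F} _ = refl
    vectors-injective {1F} {2F} (p , _) = ⊥-elim (1≉0 (K.sym p))
    vectors-injective {1F} {3F} (p , _) = ⊥-elim (1≉0 (K.sym p))
    vectors-injective {2F} {0F} (_ , p) = ⊥-elim (1≉0 p)
    vectors-injective {2F} {1F} (p , _) = ⊥-elim (1≉0 p)
    vectors-injective {2F} {2F} _ = refl
    vectors-injective {2F} {3F} (_ , p) = ⊥-elim (t≉1 (K.sym p))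
    vectors-injective {3F} {0F} (_ , p) = ⊥-elim (t≉0 p)
    vectors-injective {3F} {1F} (p , _) = ⊥-elim (1≉0 p)
    vectors-injective {3F} {2F} (_ , p) = ⊥-elim (t≉1 p)
    vectors-injective {3F} {3F} _ = refl

    combination : (Fin 4 → Carrier) → Carrier × Carrier
    combination a = Sum.sum (Module.+ᴹ-commutativeMonoid K²) λ i → Module._*ₗ_ K² (a i) (vectors i)

    combination₁ : ∀ a → proj₁ (combination a) ≈ a 0F K.+ (a 2F K.+ a 3F)
    combination₁ a = +-cong (*-identityʳ _) (K.trans (+-cong (zeroʳ _)
      (+-cong (*-identityʳ _) (K.trans (+-identityʳ _) (*-identityʳ _)))) (+-identityˡ _))

    combination₂ : ∀ a → proj₂ (combination a) ≈ a 1F K.+ (a 2F K.+ a 3F * t)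
    combination₂ a = K.trans (+-cong (zeroʳ _) (+-cong (*-identityʳ _)
      (+-cong (*-identityʳ _) (+-identityʳ _)))) (+-identityˡ _)

    module _ {a : Fin 4 → Carrier} (relation : Module._≈ᴹ_ K² (combination a) (Module.0ᴹ K²)) where
      private
        e₁ : a 0F K.+ (a 2F K.+ a 3F) ≈ 0#
        e₁ = K.trans (K.sym (combination₁ a)) (proj₁ relation)

        e₂ : a 1F K.+ (a 2F K.+ a 3F * t) ≈ 0#
        e₂ = K.trans (K.sym (combination₂ a)) (proj₂ relation)

        x≈0⇒x*t≈0 : ∀ {x} → x ≈ 0# → x * t ≈ 0#
        x≈0⇒x*t≈0 x≈0 = K.trans (*-congʳ x≈0) (zeroˡ t)

        0+0≈0 : ∀ {x y} → x ≈ 0# → y ≈ 0# → x K.+ y ≈ 0#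
        0+0≈0 x≈0 y≈0 = K.trans (+-cong x≈0 y≈0) (+-identityˡ 0#)

        -- The equations express `a 0F` and `a 1F` through the other two coefficients, so all cases
        -- reduce to this one.
        vanish₂₃ : a 2F ≈ 0# → a 3F ≈ 0# → ∀ i → a i ≈ 0#
        vanish₂₃ p q 0F = y≈0∧x+y≈0⇒x≈0 (0+0≈0 p q) e₁
        vanish₂₃ p q 1F = y≈0∧x+y≈0⇒x≈0 (0+0≈0 p (x≈0⇒x*t≈0 q)) e₂
        vanish₂₃ p q 2F = p
        vanish₂₃ p q 3F = q

        -- Comparing the equations gives `a 3F * (t - 1) ≈ 0`, and `t≉1` applies.
        vanish₀₁ : a 0F ≈ 0# → a 1F ≈ 0# → ∀ i → a i ≈ 0#
        vanish₀₁ p q = vanish₂₃ (y≈0∧x+y≈0⇒x≈0 a₃≈0 f₁) a₃≈0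
          where
          f₁ : a 2F K.+ a 3F ≈ 0#
          f₁ = x≈0∧x+y≈0⇒y≈0 p e₁

          f₂ : a 2F K.+ a 3F * t ≈ 0#
          f₂ = x≈0∧x+y≈0⇒y≈0 q e₂

          a₃t≈a₃ : a 3F * t ≈ a 3F
          a₃t≈a₃ = RingProperties.+-cancelˡ ring (a 2F) _ _ (K.trans f₂ (K.sym f₁))

          a₃≈0 : a 3F ≈ 0#
          a₃≈0 = x*y≈0⇒x≈0 (λ t-1≈0 → t≉1 (RingProperties.x∙y⁻¹≈ε⇒x≈y ring t 1# t-1≈0)) (begin
            a 3F * (t K.- 1#)            ≈⟨ RingProperties.x[y-z]≈xy-xz ring (a 3F) t 1# ⟩
            a 3F * t K.- a 3F * 1#       ≈⟨ +-cong a₃t≈a₃ (-‿cong (*-identityʳ _)) ⟩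
            a 3F K.- a 3F                ≈⟨ -‿inverseʳ _ ⟩
            0#                           ∎)
            where open SetoidReasoning K.setoid

        vanish₀₂ : a 0F ≈ 0# → a 2F ≈ 0# → ∀ i → a i ≈ 0#
        vanish₀₂ p q = vanish₂₃ q (x≈0∧x+y≈0⇒y≈0 q (x≈0∧x+y≈0⇒y≈0 p e₁))

        vanish₀₃ : a 0F ≈ 0# → a 3F ≈ 0# → ∀ i → a i ≈ 0#
        vanish₀₃ p q = vanish₂₃ (y≈0∧x+y≈0⇒x≈0 q (x≈0∧x+y≈0⇒y≈0 p e₁)) q

        -- The second equation becomes `a 3F * t ≈ 0`, and `t≉0` applies.
        vanish₁₂ : a 1F ≈ 0# → a 2F ≈ 0# → ∀ i → a i ≈ 0#
        vanish₁₂ p q = vanish₂₃ q (x*y≈0⇒x≈0 t≉0 (x≈0∧x+y≈0⇒y≈0 q (x≈0∧x+y≈0⇒y≈0 p e₂)))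

        vanish₁₃ : a 1F ≈ 0# → a 3F ≈ 0# → ∀ i → a i ≈ 0#
        vanish₁₃ p q = vanish₂₃ (y≈0∧x+y≈0⇒x≈0 (x≈0⇒x*t≈0 q) (x≈0∧x+y≈0⇒y≈0 p e₂)) q

      two-zeros⇒trivial : ∀ p q → p ≢ q → a p ≈ 0# → a q ≈ 0# → ∀ i → a i ≈ 0#
      two-zeros⇒trivial 0F 0F p≢q _ _ = ⊥-elim (p≢q refl)
      two-zeros⇒trivial 0F 1F _ x y = vanish₀₁ x y
      two-zeros⇒trivial 0F 2F _ x y = vanish₀₂ x y
      two-zeros⇒trivial 0F 3F _ x y = vanish₀₃ x y
      two-zeros⇒trivial 1F 0F _ x y = vanish₀₁ y x
      two-zeros⇒trivial 1F 1F p≢q _ _ = ⊥-elim (p≢q refl)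
      two-zeros⇒trivial 1F 2F _ x y = vanish₁₂ x y
      two-zeros⇒trivial 1F 3F _ x y = vanish₁₃ x y
      two-zeros⇒trivial 2F 0F _ x y = vanish₀₂ y x
      two-zeros⇒trivial 2F 1F _ x y = vanish₁₂ y x
      two-zeros⇒trivial 2F 2F p≢q _ _ = ⊥-elim (p≢q refl)
      two-zeros⇒trivial 2F 3F _ x y = vanish₂₃ x y
      two-zeros⇒trivial 3F 0F _ x y = vanish₀₃ y x
      two-zeros⇒trivial 3F 1F _ x y = vanish₁₃ y x
      two-zeros⇒trivial 3F 2F _ x y = vanish₂₃ y x
      two-zeros⇒trivial 3F 3F p≢q _ _ = ⊥-elim (p≢q refl)

    missing-two⇒independent : ∀ {S p q} → p ≢ q → p Subset.∉ S → q Subset.∉ S →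
      ¬ LinearlyDependent K K² vectors S
    missing-two⇒independent {p = p} {q} p≢q p∉S q∉S (a , off-S , (i , _ , ai≉0) , relation) =
      ai≉0 (two-zeros⇒trivial relation p q p≢q (off-S p p∉S) (off-S q q∉S) i)

    -- The linear relations among the vectors, parametrised by their last two coefficients.
    solution : Carrier → Carrier → Fin 4 → Carrier
    solution a₂ a₃ 0F = - (a₂ K.+ a₃)
    solution a₂ a₃ 1F = - (a₂ K.+ a₃ * t)
    solution a₂ a₃ 2F = a₂
    solution a₂ a₃ 3F = a₃

    triple-dependent : ∀ p → LinearlyDependent K K² vectors (∁ ⁅ p ⁆)
    triple-dependent p = a p , (λ i i∉ → K.trans (reflexive (cong (a p) (x∉∁⁅y⁆⇒x≡y i∉))) (a-zero p)) , a-nonzero p ,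
      (K.trans (combination₁ (a p)) (-‿inverseˡ _) , K.trans (combination₂ (a p)) (-‿inverseˡ _))
      where
      -- The free coefficients make coefficient `p` vanish: `a₂ + a₃ ≈ 0` for the first vector and
      -- `a₂ + a₃ * t ≈ 0` for the second.
      a₂ a₃ : Fin 4 → Carrier
      a₂ 0F = - 1#
      a₂ 1F = - t
      a₂ 2F = 0#
      a₂ 3F = 1#
      a₃ 3F = 0#
      a₃ _  = 1#

      a : Fin 4 → Fin 4 → Carrier
      a p = solution (a₂ p) (a₃ p)

      -0≈ : ∀ {x} → x ≈ 0# → - x ≈ 0#
      -0≈ x≈0 = K.trans (-‿cong x≈0) (RingProperties.-0#≈0# ring)

      a-zero : ∀ p → a p p ≈ 0#
      a-zero 0F = -0≈ (-‿inverseˡ 1#)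
      a-zero 1F = -0≈ (K.trans (+-congˡ (*-identityˡ t)) (-‿inverseˡ t))
      a-zero 2F = K.refl
      a-zero 3F = K.refl

      a-nonzero : ∀ p → ∃[ i ] i Subset.∈ ∁ ⁅ p ⁆ × ¬ (a p i ≈ 0#)
      a-nonzero 0F = 3F , x∈∁⁅y⁆ {y = 0F} (λ ()) , 1≉0
      a-nonzero 1F = 3F , x∈∁⁅y⁆ {y = 1F} (λ ()) , 1≉0
      a-nonzero 2F = 3F , x∈∁⁅y⁆ {y = 2F} (λ ()) , 1≉0
      a-nonzero 3F = 2F , x∈∁⁅y⁆ {y = 3F} (λ ()) , 1≉0

    triple-minimal : ∀ {S p} → S ≡ ∁ ⁅ p ⁆ → MinimallyDependent K K² vectors S
    triple-minimal {p = p} refl = triple-dependent p , λ T (T⊆ , q , q∈ , q∉T) →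
      missing-two⇒independent (x∈∁⁅y⁆⇒x≢y q∈ ∘ ≡.sym) (λ p∈T → x∈∁⁅y⁆⇒x≢y (T⊆ p∈T) refl) q∉T

    -- The full set properly contains a dependent triple, and a set missing two elements is
    -- independent; so exactly one element is missing.
    minimal⇒triple : ∀ {S} → MinimallyDependent K K² vectors S → ∃[ p ] S ≡ ∁ ⁅ p ⁆
    minimal⇒triple {S} (dep , min) with nonempty? (∁ S)
    ... | no  full = ⊥-elim (min (∁ ⁅ 0F ⁆) ((λ _ → ∈S) , 0F , ∈S , λ 0∈ → x∈∁⁅y⁆⇒x≢y 0∈ refl) (triple-dependent 0F))
      where
      ∈S : ∀ {i} → i Subset.∈ S
      ∈S {i} = x∉∁p⇒x∈p λ i∈ → full (i , i∈)
    ... | yes (p , p∈) = p , ⊆-antisym (λ i∈S → x∈∁⁅y⁆ λ { refl → p∉S i∈S }) λ {i} i∈ →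
            decidable-stable (i ∈? S) λ i∉S → missing-two⇒independent (x∈∁⁅y⁆⇒x≢y i∈) i∉S p∉S dep
      where
      p∉S : p Subset.∉ S
      p∉S = x∈∁p⇒x∉p p∈

    U₂,₄-representable : Representable U₂,₄ K
    U₂,₄-representable = K² , 4 , vectors , vectors-injective , ↔-id (Fin 4) , λ S →
      -- The image under the identity is `tabulate (lookup S)`, which equals `S` only
      -- propositionally.
      mk⇔ (λ (p , eq) → triple-minimal (≡.trans (tabulate∘lookup S) eq))
          (λ min → let p , eq = minimal⇒triple min in p , ≡.trans (≡.sym (tabulate∘lookup S)) eq)

  -- Either some element other than 0 and 1 serves as `t`, or every element is a bit and the field
  -- is 𝔽₂ after all.
  ≇𝔽₂⇒U₂,₄-representable : (∀ {a} → ExcludedMiddle a) → ¬ (K ≅ᶠ 𝔽₂) → Representable U₂,₄ K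
  ≇𝔽₂⇒U₂,₄-representable em K≇𝔽₂ with em {P = ∃[ t ] ¬ (t ≈ 0#) × ¬ (t ≈ 1#)}
  ... | yes (t , t≉0 , t≉1) = U₂,₄-representable t t≉0 t≉1
  ... | no  ¬t = ⊥-elim (K≇𝔽₂ (all-bits⇒≅𝔽₂ bits))
    where
    bits : ∀ x → ∃[ b ] x ≈ bit b
    bits x with em {P = x ≈ 0#}
    ... | yes x≈0 = false , x≈0
    ... | no  x≉0 = true , decidable-stable em λ x≉1 → ¬t (x , x≉0 , x≉1)

theorem5 : (∀ {a} → ExcludedMiddle a) →
    ∀ {c ℓ f} (F : Pred (Field c ℓ) f) →
    (∀ {n} (M : Matroid n) → Simple M → (∀ K → K ∈ F → Representable M K) →
    HasUniqueMinimalTropicalBasis M)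
    ⇔ (∃[ K ] K ∈ F × K ≅ᶠ 𝔽₂)
theorem5 em F = mk⇔
  -- If no member of `F` is 𝔽₂, then U₂,₄ is representable over all of them and contradicts
  -- uniqueness.
  (λ unique → decidable-stable em λ no-𝔽₂ → U₂,₄-not-unique em
    (unique U₂,₄ U₂,₄-simple λ K K∈F → Plane.≇𝔽₂⇒U₂,₄-representable K em λ K≅𝔽₂ → no-𝔽₂ (K , K∈F , K≅𝔽₂)))
  (λ (K , K∈F , K≅𝔽₂) M simple representable →
    binary⇒unique em {M = M} simple (Bits.cycleSpace K K≅𝔽₂ (representable K K∈F)))
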